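{- Let $r\in\mathbb{N}$. For any $m_1,\ldots,m_r\in \mathbb{N}$, with $m=\operatorname{lcm}[m_1,\ldots,m_r]$, $$A(m_1,\ldots,m_r)= \frac1{m} \sum_{d\mid m} \gcd(d,m_1) \cdots \gcd(d,m_r)\, \phi(m/d).$$
   Context: $\mathbb{N}=\{1,2,\ldots\}$. $\phi$ is Euler's totient function. The function $A$ is defined by $A(m_1,\ldots,m_r)=\frac1{m}\sum_{k=1}^m\gcd(k,m_1)\cdots\gcd(k,m_r)$ with $m=\operatorname{lcm}[m_1,\ldots,m_r]$. The sum in the claim is over positive divisors $d$ of $m$. -}

module Defs where

open import Data.Integer.Base using (+_)
open import Data.List.Base as List using (List; length; filter; upTo)
open import Data.Nat.Base using (ℕ; suc; _*_; NonZero; ≢-nonZero; ≢-nonZero⁻¹)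
open import Data.Nat.Coprimality using (coprime?)
open import Data.Nat.Divisibility using (_∣?_)
open import Data.Nat.GCD using (gcd)
open import Data.Nat.LCM using (lcm; gcd*lcm)
open import Data.Nat.ListAction using (sum)
open import Data.Nat.Properties using (m*n≢0; *-zeroʳ)
open import Data.Rational.Base as ℚ using (ℚ; _/_)
open import Data.Vec.Base as Vec using (Vec; foldr′)
open import Data.Vec.Relation.Unary.All using (All; []; _∷_)
open import Relation.Binary.PropositionalEquality using (cong; sym; trans)

∑₁ : ℕ → (ℕ → ℕ) → ℕ
∑₁ n f = sum (List.map (λ i → f (suc i)) (upTo n))

-- For n ≥ 1 every divisor of n is suc i for exactly one i < n.  Handing the
-- summand a literal successor makes  n / d  available to it.
∑∣ : ℕ → ((d : ℕ) .{{_ : NonZero d}} → ℕ) → ℕ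
∑∣ n f = sum (List.map (λ i → f (suc i)) (filter (λ i → suc i ∣? n) (upTo n)))

φ : ℕ → ℕ
φ n = length (filter (λ k → coprime? k n) (List.map suc (upTo n)))

lcms : ∀ {r} → Vec ℕ r → ℕ
lcms = foldr′ lcm 1

gcdProduct : ∀ {r} → ℕ → Vec ℕ r → ℕ
gcdProduct k ms = foldr′ _*_ 1 (Vec.map (gcd k) ms)

lcm-nonZero : ∀ m n .{{_ : NonZero m}} .{{_ : NonZero n}} → NonZero (lcm m n)
lcm-nonZero m n = ≢-nonZero λ lcm≡0 →
  ≢-nonZero⁻¹ (m * n) {{m*n≢0 m n}}
    (trans (sym (gcd*lcm m n)) (trans (cong (gcd m n *_) lcm≡0) (*-zeroʳ (gcd m n))))

lcms-nonZero : ∀ {r} {ms : Vec ℕ r} → All NonZero ms → NonZero (lcms ms)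
lcms-nonZero []                             = _
lcms-nonZero {ms = m Vec.∷ ms} (m≢0 ∷ ms≢0) =
  lcm-nonZero m (lcms ms) {{m≢0}} {{lcms-nonZero ms≢0}}

A : ∀ {r} (ms : Vec ℕ r) → All NonZero ms → ℚ
A ms ms≢0 =
  let m = lcms ms in
  (+ 1 / m) {{lcms-nonZero ms≢0}} ℚ.* (+ ∑₁ m (λ k → gcdProduct k ms) / 1)

{-# OPTIONS --safe #-}
-- Since every mᵢ divides m, gcd(k,mᵢ) = gcd(gcd(k,m),mᵢ), so the summand of A
-- depends on k only through d = gcd(k,m).  The k ∈ {1,…,m} with gcd(k,m) = d
-- are the multiples d·j with j ∈ {1,…,m/d} coprime to m/d, and there are
-- φ(m/d) of them.
module Submission where

open import Defs
open import Algebra.Properties.CommutativeSemigroup using (interchange)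
open import Data.Bool.Base using (if_then_else_)
open import Data.Integer.Base using (+_)
open import Data.List.Base as List using ([]; _∷_; _∷ʳ_; filter; length; upTo)
open import Data.List.Properties using (map-++; map-∘; upTo-∷ʳ)
open import Data.Nat.Base
  using (ℕ; zero; suc; _+_; _*_; _/_; _≤_; s≤s; NonZero; ≢-nonZero; ≢-nonZero⁻¹)
open import Data.Nat.Coprimality using (Coprime; coprime?; coprime⇒gcd≡1; gcd≡1⇒coprime)
open import Data.Nat.DivMod using (m*n/n≡m)
open import Data.Nat.Divisibility
open import Data.Nat.GCD
open import Data.Nat.LCM using (m∣lcm[m,n]; n∣lcm[m,n])
open import Data.Nat.ListAction using (sum)
open import Data.Nat.ListAction.Properties using (sum-++)
open import Data.Nat.Properties
open import Data.Rational.Base as ℚ using (ℚ)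
open import Data.Sum.Base using (inj₂)
open import Data.Vec.Base using (Vec; []; _∷_)
open import Data.Vec.Relation.Unary.All using (All)
open import Function.Base using (_∘_)
open import Function.Bundles using (_⇔_; mk⇔)
open import Relation.Binary.PropositionalEquality
open import Relation.Nullary.Decidable.Core using (Dec; yes; no; does)
open import Relation.Nullary.Decidable using (does-⇔; dec-true; dec-false)
open import Relation.Nullary.Negation.Core using (¬_)
open import Relation.Unary using (Pred; Decidable)

open ≡-Reasoning

-- Turns counting into summation, so that counts can be scaled and interchanged like any other `∑₁`.
-- It reads only `does`, so equivalent decisions give equal values whatever their proofs.
𝟙 : ∀ {p} {P : Set p} → Dec P → ℕ
𝟙 P? = if does P? then 1 else 0

𝟙-cong : ∀ {p q} {P : Set p} {Q : Set q} → P ⇔ Q → (P? : Dec P) (Q? : Dec Q) → 𝟙 P? ≡ 𝟙 Q?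
𝟙-cong P⇔Q P? Q? = cong (if_then 1 else 0) (does-⇔ P⇔Q P? Q?)

𝟙-true : ∀ {p} {P : Set p} (P? : Dec P) → P → 𝟙 P? ≡ 1
𝟙-true P? p = cong (if_then 1 else 0) (dec-true P? p)

𝟙-false : ∀ {p} {P : Set p} (P? : Dec P) → ¬ P → 𝟙 P? ≡ 0
𝟙-false P? ¬p = cong (if_then 1 else 0) (dec-false P? ¬p)

sum-filter : ∀ {a p} {X : Set a} {P : Pred X p} (P? : Decidable P) {f g : X → ℕ} →
  (∀ x → P x → f x ≡ g x) → (∀ x → ¬ P x → g x ≡ 0) →
  ∀ xs → sum (List.map f (filter P? xs)) ≡ sum (List.map g xs)
sum-filter P? f≡g g≡0 [] = refl
sum-filter P? f≡g g≡0 (x ∷ xs) with P? x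
... | yes p = cong₂ _+_ (f≡g x p) (sum-filter P? f≡g g≡0 xs)
... | no ¬p = cong₂ _+_ (sym (g≡0 x ¬p)) (sum-filter P? f≡g g≡0 xs)

length-filter≡sum : ∀ {a p} {X : Set a} {P : Pred X p} (P? : Decidable P) →
  ∀ xs → length (filter P? xs) ≡ sum (List.map (𝟙 ∘ P?) xs)
length-filter≡sum P? [] = refl
length-filter≡sum P? (x ∷ xs) with P? x
... | yes _ = cong suc (length-filter≡sum P? xs)
... | no  _ = length-filter≡sum P? xs

-- `upTo` unfolds from the front, so the last term does not split off by computation. The inductions
-- on `∑₁` below peel from this end, which leaves the summand unshifted.
∑₁-suc : ∀ n f → ∑₁ (suc n) f ≡ ∑₁ n f + f (suc n)
∑₁-suc n f = begin
  sum (List.map g (upTo (suc n)))           ≡⟨ cong (sum ∘ List.map g) (upTo-∷ʳ n) ⟨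
  sum (List.map g (upTo n ∷ʳ n))            ≡⟨ cong sum (map-++ g (upTo n) (n ∷ [])) ⟩
  sum (List.map g (upTo n) ∷ʳ g n)          ≡⟨ sum-++ (List.map g (upTo n)) (g n ∷ []) ⟩
  sum (List.map g (upTo n)) + (g n + 0)     ≡⟨ cong (λ s → ∑₁ n f + s) (+-identityʳ (g n)) ⟩
  sum (List.map g (upTo n)) + g n           ∎
  where g = f ∘ suc

∑₁-cong : ∀ n {f g} → (∀ k .{{_ : NonZero k}} → k ≤ n → f k ≡ g k) → ∑₁ n f ≡ ∑₁ n g
∑₁-cong zero f≡g = refl
∑₁-cong (suc n) {f} {g} f≡g = begin
  ∑₁ (suc n) f         ≡⟨ ∑₁-suc n f ⟩
  ∑₁ n f + f (suc n)   ≡⟨ cong₂ _+_ (∑₁-cong n λ k k≤n → f≡g k (m≤n⇒m≤1+n k≤n)) (f≡g (suc n) ≤-refl) ⟩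
  ∑₁ n g + g (suc n)   ≡⟨ ∑₁-suc n g ⟨
  ∑₁ (suc n) g         ∎

∑₁-zero : ∀ n → ∑₁ n (λ _ → 0) ≡ 0
∑₁-zero zero    = refl
∑₁-zero (suc n) = trans (∑₁-suc n (λ _ → 0)) (cong (_+ 0) (∑₁-zero n))

∑₁-+ : ∀ n f g → ∑₁ n (λ k → f k + g k) ≡ ∑₁ n f + ∑₁ n g
∑₁-+ zero f g = refl
∑₁-+ (suc n) f g = begin
  ∑₁ (suc n) (λ k → f k + g k)                   ≡⟨ ∑₁-suc n (λ k → f k + g k) ⟩
  ∑₁ n (λ k → f k + g k) + (f (suc n) + g (suc n)) ≡⟨ cong (_+ (f (suc n) + g (suc n))) (∑₁-+ n f g) ⟩
  ∑₁ n f + ∑₁ n g + (f (suc n) + g (suc n))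
    ≡⟨ interchange +-commutativeSemigroup (∑₁ n f) (∑₁ n g) (f (suc n)) (g (suc n)) ⟩
  ∑₁ n f + f (suc n) + (∑₁ n g + g (suc n))      ≡⟨ cong₂ _+_ (∑₁-suc n f) (∑₁-suc n g) ⟨
  ∑₁ (suc n) f + ∑₁ (suc n) g                    ∎

∑₁-*ˡ : ∀ n c f → ∑₁ n (λ k → c * f k) ≡ c * ∑₁ n f
∑₁-*ˡ zero c f = sym (*-zeroʳ c)
∑₁-*ˡ (suc n) c f = begin
  ∑₁ (suc n) (λ k → c * f k)              ≡⟨ ∑₁-suc n (λ k → c * f k) ⟩
  ∑₁ n (λ k → c * f k) + c * f (suc n)    ≡⟨ cong (_+ c * f (suc n)) (∑₁-*ˡ n c f) ⟩
  c * ∑₁ n f + c * f (suc n)              ≡⟨ *-distribˡ-+ c (∑₁ n f) (f (suc n)) ⟨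
  c * (∑₁ n f + f (suc n))                ≡⟨ cong (c *_) (∑₁-suc n f) ⟨
  c * ∑₁ (suc n) f                        ∎

∑₁-swap : ∀ m n (f : ℕ → ℕ → ℕ) → ∑₁ m (λ i → ∑₁ n (f i)) ≡ ∑₁ n (λ j → ∑₁ m (λ i → f i j))
∑₁-swap zero n f = sym (∑₁-zero n)
∑₁-swap (suc m) n f = begin
  ∑₁ (suc m) (λ i → ∑₁ n (f i))                        ≡⟨ ∑₁-suc m (λ i → ∑₁ n (f i)) ⟩
  ∑₁ m (λ i → ∑₁ n (f i)) + ∑₁ n (f (suc m))           ≡⟨ cong (_+ ∑₁ n (f (suc m))) (∑₁-swap m n f) ⟩
  ∑₁ n (λ j → ∑₁ m (λ i → f i j)) + ∑₁ n (f (suc m))   ≡⟨ ∑₁-+ n (λ j → ∑₁ m (λ i → f i j)) (f (suc m)) ⟨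
  ∑₁ n (λ j → ∑₁ m (λ i → f i j) + f (suc m) j)        ≡⟨ ∑₁-cong n (λ j _ → ∑₁-suc m (λ i → f i j)) ⟨
  ∑₁ n (λ j → ∑₁ (suc m) (λ i → f i j))                ∎

∑₁-split : ∀ m n f → ∑₁ (m + n) f ≡ ∑₁ m f + ∑₁ n (λ k → f (m + k))
∑₁-split m zero f = trans (cong (λ s → ∑₁ s f) (+-identityʳ m)) (sym (+-identityʳ _))
∑₁-split m (suc n) f = begin
  ∑₁ (m + suc n) f                                        ≡⟨ cong (λ s → ∑₁ s f) (+-suc m n) ⟩
  ∑₁ (suc (m + n)) f                                      ≡⟨ ∑₁-suc (m + n) f ⟩
  ∑₁ (m + n) f + f (suc (m + n))
    ≡⟨ cong₂ _+_ (∑₁-split m n f) (cong f (sym (+-suc m n))) ⟩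
  ∑₁ m f + ∑₁ n (λ k → f (m + k)) + f (m + suc n)         ≡⟨ +-assoc (∑₁ m f) _ _ ⟩
  ∑₁ m f + (∑₁ n (λ k → f (m + k)) + f (m + suc n))       ≡⟨ cong (λ s → ∑₁ m f + s) (∑₁-suc n (λ k → f (m + k))) ⟨
  ∑₁ m f + ∑₁ (suc n) (λ k → f (m + k))                   ∎

-- Vanishing is asked for only on 1, ..., `n`: in `∑₁-multiples` the sum runs over one block of a
-- longer range, and the summand may be nonzero outside that block.
∑₁-single : ∀ n {f} a .{{_ : NonZero a}} → a ≤ n →
  (∀ k .{{_ : NonZero k}} → k ≤ n → k ≢ a → f k ≡ 0) → ∑₁ n f ≡ f a
∑₁-single zero (suc _) ()
∑₁-single (suc n) {f} a a≤1+n f≡0 with a ≟ suc n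
... | yes refl = begin
  ∑₁ (suc n) f                   ≡⟨ ∑₁-suc n f ⟩
  ∑₁ n f + f (suc n)
    ≡⟨ cong (_+ f (suc n)) (∑₁-cong n λ k k≤n → f≡0 k (m≤n⇒m≤1+n k≤n) (<⇒≢ (s≤s k≤n))) ⟩
  ∑₁ n (λ _ → 0) + f (suc n)     ≡⟨ cong (_+ f (suc n)) (∑₁-zero n) ⟩
  f (suc n)                      ∎
... | no a≢1+n = begin
  ∑₁ (suc n) f                   ≡⟨ ∑₁-suc n f ⟩
  ∑₁ n f + f (suc n)
    ≡⟨ cong₂ _+_ (∑₁-single n a (≤-pred (≤∧≢⇒< a≤1+n a≢1+n)) λ k k≤n → f≡0 k (m≤n⇒m≤1+n k≤n))
                 (f≡0 (suc n) ≤-refl (a≢1+n ∘ sym)) ⟩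
  f a + 0                        ≡⟨ +-identityʳ (f a) ⟩
  f a                            ∎

-- Induction on `q` cuts the range into blocks of length `d`. The last block is `q * d + 1`, ...,
-- `q * d + d`, and its only multiple of `d` is its right end.
∑₁-multiples : ∀ q d .{{_ : NonZero d}} {f} → (∀ k → ¬ d ∣ k → f k ≡ 0) →
  ∑₁ (q * d) f ≡ ∑₁ q (λ j → f (j * d))
∑₁-multiples zero d f≡0 = refl
∑₁-multiples (suc q) d {f} f≡0 = begin
  ∑₁ (d + q * d) f                                 ≡⟨ cong (λ s → ∑₁ s f) (+-comm d (q * d)) ⟩
  ∑₁ (q * d + d) f                                 ≡⟨ ∑₁-split (q * d) d f ⟩
  ∑₁ (q * d) f + ∑₁ d (λ k → f (q * d + k))
    ≡⟨ cong₂ _+_ (∑₁-multiples q d f≡0) (∑₁-single d d ≤-refl off-multiple) ⟩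
  ∑₁ q (λ j → f (j * d)) + f (q * d + d)
    ≡⟨ cong (λ s → ∑₁ q (λ j → f (j * d)) + f s) (+-comm (q * d) d) ⟩
  ∑₁ q (λ j → f (j * d)) + f (suc q * d)           ≡⟨ ∑₁-suc q (λ j → f (j * d)) ⟨
  ∑₁ (suc q) (λ j → f (j * d))                     ∎
  where
  off-multiple : ∀ k .{{_ : NonZero k}} → k ≤ d → k ≢ d → f (q * d + k) ≡ 0
  -- Since `k` is positive, `d ∣ k` would force `d ≤ k`, hence `k ≡ d`.
  off-multiple k k≤d k≢d = f≡0 (q * d + k) λ d∣qd+k →
    k≢d (≤-antisym k≤d (∣⇒≤ (∣m+n∣m⇒∣n d∣qd+k (n∣m*n q))))

-- The summand `f` may mention `n / d` and so lives on nonzero `d` only; `g` is a total function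
-- that extends it by zero off the divisors. This puts a divisor sum in a form where the `∑₁` lemmas
-- apply.
∑∣≡∑₁ : ∀ n {f : (d : ℕ) .{{_ : NonZero d}} → ℕ} {g} →
  (∀ d .{{_ : NonZero d}} → d ∣ n → f d ≡ g d) → (∀ d → ¬ d ∣ n → g d ≡ 0) → ∑∣ n f ≡ ∑₁ n g
∑∣≡∑₁ n f≡g g≡0 =
  sum-filter (λ i → suc i ∣? n) (λ i → f≡g (suc i)) (λ i → g≡0 (suc i)) (upTo n)

φ≡∑₁ : ∀ n → φ n ≡ ∑₁ n (λ k → 𝟙 (coprime? k n))
φ≡∑₁ n = trans (length-filter≡sum (λ k → coprime? k n) (List.map suc (upTo n)))
               (cong sum (sym (map-∘ (upTo n))))

#gcd : ℕ → ℕ → ℕ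
#gcd n d = ∑₁ n (λ k → 𝟙 (gcd k n ≟ d))

#gcd-nondivisor : ∀ n d → ¬ d ∣ n → #gcd n d ≡ 0
#gcd-nondivisor n d d∤n =
  trans (∑₁-cong n λ k _ → 𝟙-false (gcd k n ≟ d) λ { refl → d∤n (gcd[m,n]∣n k n) }) (∑₁-zero n)

-- The common factor `d` comes out of the gcd, and being nonzero it cancels, leaving `gcd j q ≡ 1`.
gcd[j*d,q*d]≡d⇔coprime : ∀ j q d .{{_ : NonZero d}} → gcd (j * d) (q * d) ≡ d ⇔ Coprime j q
gcd[j*d,q*d]≡d⇔coprime j q d = mk⇔ to from
  where
  gcd-scale : gcd (j * d) (q * d) ≡ d * gcd j q
  gcd-scale = trans (cong₂ gcd (*-comm j d) (*-comm q d)) (sym (c*gcd[m,n]≡gcd[cm,cn] d j q))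

  to : gcd (j * d) (q * d) ≡ d → Coprime j q
  to eq = gcd≡1⇒coprime (*-cancelˡ-≡ (gcd j q) 1 d
    (trans (sym gcd-scale) (trans eq (sym (*-identityʳ d)))))

  from : Coprime j q → gcd (j * d) (q * d) ≡ d
  from c = trans gcd-scale (trans (cong (d *_) (coprime⇒gcd≡1 c)) (*-identityʳ d))

#gcd-divisor : ∀ n d .{{_ : NonZero d}} → d ∣ n → #gcd n d ≡ φ (n / d)
-- Matching replaces `n` by `q * d`: the range then consists of `q` whole blocks of length `d`, and
-- `n / d` simplifies to `q`.
#gcd-divisor n d (divides-refl q) = begin
  ∑₁ (q * d) (λ k → 𝟙 (gcd k (q * d) ≟ d))
    ≡⟨ ∑₁-multiples q d (λ k d∤k → 𝟙-false (gcd k (q * d) ≟ d) λ eq →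
         d∤k (subst (_∣ k) eq (gcd[m,n]∣m k (q * d)))) ⟩
  ∑₁ q (λ j → 𝟙 (gcd (j * d) (q * d) ≟ d))
    ≡⟨ ∑₁-cong q (λ j _ → 𝟙-cong (gcd[j*d,q*d]≡d⇔coprime j q d) (gcd (j * d) (q * d) ≟ d) (coprime? j q)) ⟩
  ∑₁ q (λ j → 𝟙 (coprime? j q))    ≡⟨ φ≡∑₁ q ⟨
  φ q                              ≡⟨ cong φ (m*n/n≡m q d) ⟨
  φ (q * d / d)                    ∎

-- The grouping by gcd is a double count: `F (gcd k n)` is written as a sum over all `d` of `F d`
-- times an indicator, and exchanging the two sums leaves `#gcd n d` as the weight of `F d`.
∑₁-gcd : ∀ n .{{_ : NonZero n}} (F : ℕ → ℕ) →
  ∑₁ n (λ k → F (gcd k n)) ≡ ∑∣ n (λ d → F d * φ (n / d))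
∑₁-gcd n F = begin
  ∑₁ n (λ k → F (gcd k n))                              ≡⟨ ∑₁-cong n (λ k _ → sym (pick k)) ⟩
  ∑₁ n (λ k → ∑₁ n (λ d → F d * 𝟙 (gcd k n ≟ d)))       ≡⟨ ∑₁-swap n n (λ k d → F d * 𝟙 (gcd k n ≟ d)) ⟩
  ∑₁ n (λ d → ∑₁ n (λ k → F d * 𝟙 (gcd k n ≟ d)))       ≡⟨ ∑₁-cong n (λ d _ → ∑₁-*ˡ n (F d) (λ k → 𝟙 (gcd k n ≟ d))) ⟩
  ∑₁ n (λ d → F d * #gcd n d)
    -- `F d * #gcd n d` extends `F d * φ (n / d)` by zero, because a nondivisor of `n` is never a
    -- gcd with `n`.
    ≡⟨ ∑∣≡∑₁ n (λ d d∣n → cong (F d *_) (sym (#gcd-divisor n d d∣n)))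
               (λ d d∤n → trans (cong (F d *_) (#gcd-nondivisor n d d∤n)) (*-zeroʳ (F d))) ⟨
  ∑∣ n (λ d → F d * φ (n / d))                          ∎
  where
  pick : ∀ k → ∑₁ n (λ d → F d * 𝟙 (gcd k n ≟ d)) ≡ F (gcd k n)
  pick k = begin
    ∑₁ n (λ d → F d * 𝟙 (gcd k n ≟ d))
      -- As `n` is nonzero, `gcd k n` lies between 1 and `n`, so the indicator is hit exactly once
      -- in the range.
      ≡⟨ ∑₁-single n (gcd k n) {{gcd-nonZero}} (gcd[m,n]≤n k n) (λ d _ d≢g →
           trans (cong (F d *_) (𝟙-false (gcd k n ≟ d) (d≢g ∘ sym))) (*-zeroʳ (F d))) ⟩
    F (gcd k n) * 𝟙 (gcd k n ≟ gcd k n)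
      ≡⟨ cong (F (gcd k n) *_) (𝟙-true (gcd k n ≟ gcd k n) refl) ⟩
    F (gcd k n) * 1      ≡⟨ *-identityʳ (F (gcd k n)) ⟩
    F (gcd k n)          ∎
    where gcd-nonZero = ≢-nonZero (gcd[m,n]≢0 k n (inj₂ (≢-nonZero⁻¹ n)))

-- By associativity the left side is `gcd k (gcd n m)`, and `gcd n m` is `m` because `m ∣ n`.
gcd-absorb : ∀ k {m n} → m ∣ n → gcd (gcd k n) m ≡ gcd k m
gcd-absorb k {m} {n} m∣n = trans (gcd-assoc k n m)
  (cong (gcd k) (∣-antisym (gcd[m,n]∣n n m) (gcd-greatest m∣n ∣-refl)))

-- Allowing any multiple `n` of the lcm makes the induction go through: the lcm of the tail divides
-- that of the whole list but may be smaller.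
gcdProduct-gcd : ∀ {r} k n (ms : Vec ℕ r) → lcms ms ∣ n → gcdProduct (gcd k n) ms ≡ gcdProduct k ms
gcdProduct-gcd k n []       _ = refl
gcdProduct-gcd k n (m ∷ ms) lcm∣n = cong₂ _*_
  (gcd-absorb k (∣-trans (m∣lcm[m,n] m (lcms ms)) lcm∣n))
  (gcdProduct-gcd k n ms (∣-trans (n∣lcm[m,n] m (lcms ms)) lcm∣n))

proposition14 : ∀ (r : ℕ) .{{_ : NonZero r}} (ms : Vec ℕ r) (ms≢0 : All NonZero ms) →
    let m = lcms ms in
    A ms ms≢0 ≡ (+ 1 ℚ./ m) {{lcms-nonZero ms≢0}} ℚ.* (+ ∑∣ m (λ d → gcdProduct d ms * φ (m / d)) ℚ./ 1)
proposition14 r ms ms≢0 =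
  -- Both sides carry the same factor `1 / m`, so only an identity between natural numbers remains.
  cong (λ s → (+ 1 ℚ./ m) {{lcms-nonZero ms≢0}} ℚ.* (+ s ℚ./ 1)) (begin
    ∑₁ m (λ k → gcdProduct k ms)              ≡⟨ ∑₁-cong m (λ k _ → gcdProduct-gcd k m ms ∣-refl) ⟨
    ∑₁ m (λ k → gcdProduct (gcd k m) ms)      ≡⟨ ∑₁-gcd m {{lcms-nonZero ms≢0}} (λ d → gcdProduct d ms) ⟩
    ∑∣ m (λ d → gcdProduct d ms * φ (m / d))  ∎)
  where m = lcms ms
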